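{- Let $\mathbf{u}$ be an infinite word over a finite alphabet $\mathcal{A}$ with $\#\mathcal{A}=k$, whose language $\mathcal{L}(\mathbf{u})$ is closed under reversal and whose factor complexity satisfies $\mathcal{C}(n)=(k-1)n+1$ for all $n\in\mathbb{N}$. Then the palindromic complexity satisfies $\mathcal{P}(n)+\mathcal{P}(n+1)=k+1$ for all $n\in\mathbb{N}$ if and only if every bispecial factor $w$ of $\mathbf{u}$ satisfies: (1) if $w$ is not a palindrome, then $\mathrm{b}(w)=0$; (2) if $w$ is a palindrome, then $\mathrm{b}(w)=\#\mathrm{Pext}(w)-1$.
   Context: An infinite word over a finite alphabet $\mathcal{A}$ is a one-sided infinite sequence $\mathbf{u}=u_0u_1u_2\ldots$ of letters of $\mathcal{A}$ in which every letter of $\mathcal{A}$ occurs. Its language $\mathcal{L}(\mathbf{u})$ is the set of all its finite factors (contiguous subwords), including the empty word; $\mathcal{C}(n)$ is the number of distinct factors of length $n$; $\mathbb{N}$ includes $0$. The reversal of $w=w_0\cdots w_{n-1}$ is $\overline{w}=w_{n-1}\cdots w_0$; $w$ is a palindrome if $w=\overline{w}$ (the empty word is a palindrome). $\mathcal{L}(\mathbf{u})$ is closed under reversal if $w\in\mathcal{L}(\mathbf{u})$ implies $\overline{w}\in\mathcal{L}(\mathbf{u})$. The palindromic complexity $\mathcal{P}(n)$ is the number of distinct palindromic factors of $\mathbf{u}$ of length $n$ (so $\mathcal{P}(0)=1$). For $w\in\mathcal{L}(\mathbf{u})$: $\mathrm{Lext}(w)=\{a\in\mathcal{A}: aw\in\mathcal{L}(\mathbf{u})\}$,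 $\mathrm{Rext}(w)=\{a\in\mathcal{A}: wa\in\mathcal{L}(\mathbf{u})\}$, $\mathrm{Bext}(w)=\{awb\in\mathcal{L}(\mathbf{u}): a,b\in\mathcal{A}\}$. A factor $w$ is bispecial if $\#\mathrm{Lext}(w)\ge 2$ and $\#\mathrm{Rext}(w)\ge 2$. The bilateral order of $w$ is $\mathrm{b}(w)=\#\mathrm{Bext}(w)-\#\mathrm{Rext}(w)-\#\mathrm{Lext}(w)+1$. For a palindrome $w$, $\mathrm{Pext}(w)=\{awa\in\mathcal{L}(\mathbf{u}): a\in\mathcal{A}\}$. -}

module Defs where

open import Level using (Level)
open import Data.Nat.Base using (ℕ; _+_; _≤_)
open import Data.Integer.Base as ℤ using (ℤ; +_; 1ℤ)
open import Data.List.Base using (List; _∷_; _∷ʳ_; length; reverse; applyUpTo)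
open import Data.List.Membership.Propositional using (_∈_)
open import Data.List.Relation.Unary.Unique.Propositional using (Unique)
open import Data.Product.Base using (∃-syntax; _×_)
open import Function.Bundles using (_⇔_)
open import Relation.Binary.PropositionalEquality using (_≡_)
open import Relation.Unary using (Pred)

private
  variable
    a ℓ : Level

-- Membership in the sets below is proof-relevant (a factor may occur at many
-- positions), so `∃ P ↔ Fin n` would count occurrences.  Cardinality is instead
-- given by a duplicate-free list with exactly the elements of P.  It is a
-- relation because the sets are not decidable for an arbitrary infinite word.
infix 4 _HasCard_
_HasCard_ : {X : Set a} → Pred X ℓ → ℕ → Set _
P HasCard n = ∃[ xs ] Unique xs × (∀ x → x ∈ xs ⇔ P x) × length xs ≡ n

Palindrome : {𝒜 : Set a} → Pred (List 𝒜) a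
Palindrome w = w ≡ reverse w

module _ {𝒜 : Set a} (u : ℕ → 𝒜) where

  ℒ : Pred (List 𝒜) a
  ℒ w = ∃[ i ] applyUpTo (λ j → u (i + j)) (length w) ≡ w

  ClosedUnderReversal : Set a
  ClosedUnderReversal = ∀ w → ℒ w → ℒ (reverse w)

  FactorOfLength : ℕ → Pred (List 𝒜) a
  FactorOfLength n w = ℒ w × length w ≡ n

  PalindromicFactorOfLength : ℕ → Pred (List 𝒜) a
  PalindromicFactorOfLength n w = FactorOfLength n w × Palindrome w

  Lext : List 𝒜 → Pred 𝒜 a
  Lext w x = ℒ (x ∷ w)

  Rext : List 𝒜 → Pred 𝒜 a
  Rext w x = ℒ (w ∷ʳ x)

  Bext : List 𝒜 → Pred (List 𝒜) a
  Bext w v = ℒ v × ∃[ x ] ∃[ y ] v ≡ x ∷ w ∷ʳ y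

  Pext : List 𝒜 → Pred (List 𝒜) a
  Pext w v = ℒ v × ∃[ x ] v ≡ x ∷ w ∷ʳ x

  BispecialFactor : Pred (List 𝒜) a
  BispecialFactor w = ℒ w
    × (∃[ l ] Lext w HasCard l × 2 ≤ l)
    × (∃[ r ] Rext w HasCard r × 2 ≤ r)

-- 𝒞⟨ u ⟩[ n ]≡ c reads "𝒞(n) = c for the word u"; similarly for 𝒫 and b.
infix 4 𝒞⟨_⟩[_]≡_ 𝒫⟨_⟩[_]≡_ b⟨_⟩[_]≡_

𝒞⟨_⟩[_]≡_ : {𝒜 : Set a} → (ℕ → 𝒜) → ℕ → ℕ → Set a
𝒞⟨ u ⟩[ n ]≡ c = FactorOfLength u n HasCard c

𝒫⟨_⟩[_]≡_ : {𝒜 : Set a} → (ℕ → 𝒜) → ℕ → ℕ → Set a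
𝒫⟨ u ⟩[ n ]≡ p = PalindromicFactorOfLength u n HasCard p

b⟨_⟩[_]≡_ : {𝒜 : Set a} → (ℕ → 𝒜) → List 𝒜 → ℤ → Set a
b⟨ u ⟩[ w ]≡ z = ∃[ e ] ∃[ r ] ∃[ l ]
  Bext u w HasCard e × Rext u w HasCard r × Lext u w HasCard l
  × z ≡ + e ℤ.- + r ℤ.- + l ℤ.+ 1ℤ

{-# OPTIONS --safe #-}
-- Let Γₙ be the graph whose vertices are the factors of length n up to reversal and whose
-- edges are the factors of length n + 1 up to reversal.  It is connected and its loops are
-- exactly the palindromes, so 𝒫(n) + 𝒫(n + 1) ≤ 𝒞(n + 1) - 𝒞(n) + 2, with equality if and only if
-- Γₙ without its loops is a tree.  The extensions x w y of a factor w of length n - 1 form a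
-- subgraph of Γₙ spanned by the extensions x w and w y; when Γₙ is a tree this gives
-- b(w) ≤ 0, or b(w) ≤ #Pext(w) - 1 if w is a palindrome.  On the other hand the b(w) with
-- |w| = m add up to the second difference of 𝒞, which is 0, and the numbers #Pext(w) - 1
-- over the palindromes w of length m add up to 𝒫(m + 2) - 𝒫(m).  Hence equality of the latter
-- with 0 forces equality in every bound, and conversely equality in every bound makes 𝒫
-- periodic with period 2.
module Submission where

open import Level using (Level; 0ℓ)
open import Data.Nat.Base using (ℕ; zero; suc; _+_; _*_; _∸_; _≤_; _<_; z≤n; s≤s; s≤s⁻¹)
open import Data.Nat.ListAction using (sum)
open import Data.Nat.Properties
  using (≤-refl; ≤-reflexive; ≤-trans; ≤-antisym; <-asym; ≰⇒>; m≤n⇒m<n∨m≡n; suc-injective;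
         +-suc; +-identityʳ; +-assoc; +-comm; +-mono-≤; +-monoˡ-≤; +-monoʳ-≤;
         +-cancelˡ-≡; +-cancelʳ-≡; +-cancelʳ-≤; *-cancelˡ-≡; module ≤-Reasoning)
open import Data.Nat.Tactic.RingSolver using (solve-∀)
open import Data.Integer.Base as ℤ using (+_; 0ℤ; 1ℤ)
import Data.Integer.Properties as ℤ
import Data.Integer.Tactic.RingSolver as ℤSolver
open import Data.Empty using (⊥)
open import Data.Fin.Base as Fin using (Fin; zero; suc)
import Data.Fin.Properties as Fin
open import Data.List.Base
  using (List; []; _∷_; _∷ʳ_; _++_; [_]; length; map; filter; lookup; reverse; applyUpTo; allFin;
         cartesianProduct; initLast; _∷ʳ′_)
open import Data.List.Properties
  using (length-map; length-++; length-applyUpTo; length-tabulate; length-reverse; map-injective;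
         applyUpTo-∷ʳ; ∷-injective; ∷-injectiveˡ; ∷-injectiveʳ; ∷ʳ-injective; ∷ʳ-injectiveˡ; ∷ʳ-injectiveʳ;
         reverse-++; reverse-involutive; reverse-injective; unfold-reverse)
open import Data.List.Membership.Propositional using (_∈_; find; lose)
open import Data.List.Membership.Propositional.Properties
  using (∈-lookup; ∈-map⁺; ∈-map⁻; ∈-++⁺ˡ; ∈-++⁺ʳ; ∈-++⁻; ∈-filter⁺; ∈-filter⁻; ∈-allFin;
         ∈-cartesianProduct⁺; ∈-cartesianProduct⁻)
open import Data.List.Relation.Binary.Lex.Strict using (Lex-<; <-compare)
open import Data.List.Relation.Binary.Pointwise using (Pointwise-≡⇒≡; ≡⇒Pointwise-≡)
open import Data.List.Relation.Unary.All as All using ([])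
open import Data.List.Relation.Unary.AllPairs using ([]; _∷_)
open import Data.List.Relation.Unary.Any as Any using (here; there)
open import Data.List.Relation.Unary.Any.Properties using (lookup-index)
open import Data.List.Relation.Unary.Unique.Propositional using (Unique)
import Data.List.Relation.Unary.Unique.Propositional.Properties as Unique
open import Data.Product.Base using (∃-syntax; _×_; _,_; proj₁; proj₂)
open import Data.Sum.Base as Sum using (_⊎_; inj₁; inj₂; [_,_]′)
open import Data.Unit.Base using (tt)
open import Function.Base using (_∘_; id; case_of_)
open import Function.Bundles using (_⇔_; _↔_; mk⇔; Equivalence; Inverse; Injection)
open import Function.Definitions using (StrictlySurjective)
open import Function.Properties.Inverse using (Inverse⇒Injection; ↔-sym)
open import Relation.Binary.Core using (Rel)
open import Relation.Binary.Definitions using (Trichotomous; DecidableEquality; tri<; tri≈; tri>)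
open import Relation.Binary.PropositionalEquality
  using (_≡_; refl; sym; trans; cong; cong₂; subst; subst₂; module ≡-Reasoning)
open import Relation.Nullary.Decidable using (Dec; yes; no; map′; _⊎-dec_)
open import Relation.Nullary.Negation using (¬_; contradiction)
open import Relation.Unary using (Pred; Decidable; _∪_; _∩_; _⟨⊎⟩_; _⟨×⟩_; U)
open import Defs

open Equivalence using (to; from)

private
  variable
    a ℓ ℓ₁ ℓ₂ ℓ₃ : Level
    X Y : Set a
    P : Pred X ℓ
    m n : ℕ

-- Cardinalities of predicates.

lookup-injective : {xs : List X} → Unique xs → ∀ {i j} → lookup xs i ≡ lookup xs j → i ≡ j
lookup-injective (x∉xs ∷ xs!) {zero}  {zero}  eq = refl
lookup-injective (x∉xs ∷ xs!) {zero}  {suc j} eq = contradiction eq (All.lookup x∉xs (∈-lookup j))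
lookup-injective (x∉xs ∷ xs!) {suc i} {zero}  eq = contradiction (sym eq) (All.lookup x∉xs (∈-lookup i))
lookup-injective (x∉xs ∷ xs!) {suc i} {suc j} eq = cong suc (lookup-injective xs! eq)

-- Choosing a related `y` for each listed `x` gives an injective map between the index sets of the
-- two lists. A relation takes the place of a function because the partner of `x` is found only from
-- a proof of `P x`.
card-≤ : {P : Pred X ℓ₁} {Q : Pred Y ℓ₂} → P HasCard m → Q HasCard n →
  (R : X → Y → Set ℓ₃) →
  (∀ {x} → P x → ∃[ y ] Q y × R x y) →
  (∀ {x x′ y} → P x → P x′ → R x y → R x′ y → x ≡ x′) →
  m ≤ n
card-≤ {X = X} {P = P} (xs , xs! , xs⇔ , refl) (ys , _ , ys⇔ , refl) R total inj = Fin.injective⇒≤ {f = f} f-inj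
  where
  pick : ∀ i → ∃[ y ] _ × R (lookup xs i) y
  pick i = total (xs⇔ _ .to (∈-lookup i))
  ∈ys : ∀ i → proj₁ (pick i) ∈ ys
  ∈ys i = ys⇔ _ .from (proj₁ (proj₂ (pick i)))
  f : Fin (length xs) → Fin (length ys)
  f i = Any.index (∈ys i)
  f-inj : ∀ {i j} → f i ≡ f j → i ≡ j
  f-inj {i} {j} eq = lookup-injective xs!
    (inj (xs⇔ _ .to (∈-lookup i)) (xs⇔ _ .to (∈-lookup j)) (proj₂ (proj₂ (pick i)))
      (subst (R _) (trans (lookup-index (∈ys j)) (trans (cong (lookup ys) (sym eq)) (sym (lookup-index (∈ys i)))))
        (proj₂ (proj₂ (pick j)))))

card-cong : {P : Pred X ℓ₁} {Q : Pred X ℓ₂} → (∀ {x} → P x → Q x) → (∀ {x} → Q x → P x) →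
  P HasCard n → Q HasCard n
card-cong P⊆Q Q⊆P (xs , xs! , xs⇔ , eq) =
  xs , xs! , (λ x → mk⇔ (P⊆Q ∘ xs⇔ x .to) (xs⇔ x .from ∘ Q⊆P)) , eq

card-unique : {P : Pred X ℓ₁} {Q : Pred X ℓ₂} → (∀ {x} → P x → Q x) → (∀ {x} → Q x → P x) →
  P HasCard m → Q HasCard n → m ≡ n
card-unique P⊆Q Q⊆P p q = ≤-antisym
  (card-≤ p q _≡_ (λ Px → _ , P⊆Q Px , refl) (λ _ _ eq eq′ → trans eq (sym eq′)))
  (card-≤ q p _≡_ (λ Qx → _ , Q⊆P Qx , refl) (λ _ _ eq eq′ → trans eq (sym eq′)))

card-map : {P : Pred X ℓ} (f : X → Y) → (∀ {x y} → f x ≡ f y → x ≡ y) →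
  P HasCard n → (λ y → ∃[ x ] P x × y ≡ f x) HasCard n
card-map f f-inj (xs , xs! , xs⇔ , refl) =
  map f xs , Unique.map⁺ f-inj xs! ,
  (λ y → mk⇔ (λ y∈ → let x , x∈ , eq = ∈-map⁻ f y∈ in x , xs⇔ x .to x∈ , eq)
             (λ { (x , Px , refl) → ∈-map⁺ f (xs⇔ x .from Px) })) ,
  length-map f xs

card-filter : {P : Pred X ℓ₁} {Q : Pred X ℓ₂} → Decidable Q → P HasCard n →
  ∃[ m ] (P ∩ Q) HasCard m
card-filter Q? (xs , xs! , xs⇔ , _) =
  _ , filter Q? xs , Unique.filter⁺ Q? xs! ,
  (λ x → mk⇔ (λ x∈ → let x∈xs , Qx = ∈-filter⁻ Q? x∈ in xs⇔ x .to x∈xs , Qx)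
             (λ (Px , Qx) → ∈-filter⁺ Q? (xs⇔ x .from Px) Qx)) ,
  refl

card-∪ : {P : Pred X ℓ₁} {Q : Pred X ℓ₂} → (∀ {x} → P x → Q x → ⊥) →
  P HasCard m → Q HasCard n → (P ∪ Q) HasCard (m + n)
card-∪ disjoint (xs , xs! , xs⇔ , refl) (ys , ys! , ys⇔ , refl) =
  xs ++ ys , Unique.++⁺ xs! ys! (λ (∈xs , ∈ys) → disjoint (xs⇔ _ .to ∈xs) (ys⇔ _ .to ∈ys)) ,
  (λ x → mk⇔ (λ x∈ → Sum.map (xs⇔ x .to) (ys⇔ x .to) (∈-++⁻ xs x∈))
             (λ { (inj₁ Px) → ∈-++⁺ˡ (xs⇔ x .from Px)
                ; (inj₂ Qx) → ∈-++⁺ʳ xs (ys⇔ x .from Qx) })) ,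
  length-++ xs

card-⊎ : {P : Pred X ℓ} {Q : Pred Y ℓ} → P HasCard m → Q HasCard n → (P ⟨⊎⟩ Q) HasCard (m + n)
card-⊎ p q = card-cong
  (λ { (inj₁ (_ , Px , refl)) → Px ; (inj₂ (_ , Qy , refl)) → Qy })
  (λ { {inj₁ x} Px → inj₁ (x , Px , refl) ; {inj₂ y} Qy → inj₂ (y , Qy , refl) })
  (card-∪ (λ { (_ , _ , refl) (_ , _ , ()) })
    (card-map inj₁ (λ { refl → refl }) p) (card-map inj₂ (λ { refl → refl }) q))

card-any? : {P : Pred X ℓ₁} {Q : Pred X ℓ₂} → P HasCard n → Decidable Q → Dec (∃[ x ] P x × Q x)
card-any? (xs , _ , xs⇔ , _) Q? = map′
  (λ any → let x , x∈ , Qx = find any in x , xs⇔ x .to x∈ , Qx)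
  (λ (x , Px , Qx) → lose (xs⇔ x .from Px) Qx)
  (Any.any? Q? xs)

-- As `y` determines `x`, the fibres over distinct entries are disjoint and their sizes add up.
card-fibres : {Q : X → Pred Y ℓ} {c : X → ℕ} → (∀ x → Q x HasCard c x) →
  (∀ {x x′ y} → Q x y → Q x′ y → x ≡ x′) →
  ∀ {xs} → Unique xs → (λ y → ∃[ x ] x ∈ xs × Q x y) HasCard sum (map c xs)
card-fibres card functional [] = [] , [] , (λ y → mk⇔ (λ ()) (λ ())) , refl
card-fibres card functional {x ∷ xs} (x∉xs ∷ xs!) = card-cong
  (λ { (inj₁ Qx) → x , here refl , Qx ; (inj₂ (x′ , x′∈ , Qx′)) → x′ , there x′∈ , Qx′ })
  (λ { (_ , here refl , Qx) → inj₁ Qx ; (x′ , there x′∈ , Qx′) → inj₂ (x′ , x′∈ , Qx′) })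
  (card-∪ (λ Qx (x′ , x′∈ , Qx′) → contradiction (functional Qx Qx′) (All.lookup x∉xs x′∈))
    (card x) (card-fibres card functional xs!))

card-× : {P : Pred X ℓ₁} {Q : Pred Y ℓ₂} → P HasCard m → Q HasCard n → ∃[ l ] (P ⟨×⟩ Q) HasCard l
card-× (xs , xs! , xs⇔ , _) (ys , ys! , ys⇔ , _) =
  _ , cartesianProduct xs ys , Unique.cartesianProduct⁺ xs! ys! ,
  (λ (x , y) → mk⇔
    (λ xy∈ → let x∈ , y∈ = ∈-cartesianProduct⁻ xs ys xy∈ in xs⇔ x .to x∈ , ys⇔ y .to y∈)
    (λ (Px , Qy) → ∈-cartesianProduct⁺ (xs⇔ x .from Px) (ys⇔ y .from Qy))) ,
  refl

-- Sums over lists and bounded search.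

sum-+ : (f g : X → ℕ) (xs : List X) →
  sum (map (λ x → f x + g x) xs) ≡ sum (map f xs) + sum (map g xs)
sum-+ f g []       = refl
sum-+ f g (x ∷ xs) = trans (cong (λ s → f x + g x + s) (sum-+ f g xs)) (interchange (f x) (g x) _ _)
  where
  interchange : ∀ a b c d → a + b + (c + d) ≡ a + c + (b + d)
  interchange = solve-∀

sum-≤ : {f g : X → ℕ} (xs : List X) → (∀ {x} → x ∈ xs → f x ≤ g x) →
  sum (map f xs) ≤ sum (map g xs)
sum-≤ []       f≤g = z≤n
sum-≤ (x ∷ xs) f≤g = +-mono-≤ (f≤g (here refl)) (sum-≤ xs (f≤g ∘ there))

-- The sum over the tail can only be larger on the right, so equal totals leave no room for a strict
-- inequality at the head.
sum-≡⇒≡ : {f g : X → ℕ} (xs : List X) → (∀ {x} → x ∈ xs → f x ≤ g x) →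
  sum (map f xs) ≡ sum (map g xs) → ∀ {x} → x ∈ xs → f x ≡ g x
sum-≡⇒≡ {f = f} {g} (x ∷ xs) f≤g eq = λ
  { (here refl) → head≡
  ; (there x∈)  → sum-≡⇒≡ xs (f≤g ∘ there)
      (+-cancelˡ-≡ (f x) _ _ (trans eq (cong (λ y → y + sum (map g xs)) (sym head≡)))) x∈ }
  where
  head≡ : f x ≡ g x
  head≡ = ≤-antisym (f≤g (here refl))
    (+-cancelʳ-≤ (sum (map g xs)) (g x) (f x)
      (≤-trans (≤-reflexive (sym eq)) (+-monoʳ-≤ (f x) (sum-≤ xs (f≤g ∘ there)))))

least : {P : Pred ℕ ℓ} → Decidable P → P n → ∃[ m ] P m × (∀ {i} → i < m → ¬ P i)
least {n = n} {P = P} P? Pn with search n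
  where
  search : ∀ n → (∀ {i} → i < n → ¬ P i) ⊎ ∃[ m ] P m × (∀ {i} → i < m → ¬ P i)
  search zero    = inj₁ λ ()
  search (suc n) with search n | P? n
  ... | inj₂ found | _      = inj₂ found
  ... | inj₁ ¬P    | yes Pn = inj₂ (n , Pn , ¬P)
  ... | inj₁ ¬P    | no ¬Pn = inj₁ λ i<1+n Pi →
    [ (λ i<n → ¬P i<n Pi) , (λ { refl → ¬Pn Pi }) ]′ (m≤n⇒m<n∨m≡n (s≤s⁻¹ i<1+n))
... | inj₁ ¬P    = n , Pn , ¬P
... | inj₂ found = found

applyUpTo-cong : {X : Set a} {f g : ℕ → X} → ∀ n → (∀ j → f j ≡ g j) → applyUpTo f n ≡ applyUpTo g n
applyUpTo-cong zero    f≗g = refl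
applyUpTo-cong (suc n) f≗g = cong₂ _∷_ (f≗g 0) (applyUpTo-cong n (f≗g ∘ suc))

-- Words up to reversal.

module Reversal {𝒜 : Set a} {_≺_ : Rel (List 𝒜) 0ℓ} (compare : Trichotomous _≡_ _≺_) where

  private
    variable
      v w x y : List 𝒜

  infix 4 _≟_ _∼_ _∼?_

  _≟_ : DecidableEquality (List 𝒜)
  v ≟ w with compare v w
  ... | tri< _ v≢w _ = no v≢w
  ... | tri≈ _ v≡w _ = yes v≡w
  ... | tri> _ v≢w _ = no v≢w

  ≺-asym : v ≺ w → ¬ w ≺ v
  ≺-asym {v} {w} v≺w w≺v with compare v w
  ... | tri< _ _ w⊀v = w⊀v w≺v
  ... | tri≈ v⊀w _ _ = v⊀w v≺w
  ... | tri> v⊀w _ _ = v⊀w v≺w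

  palindrome? : Decidable (Palindrome {𝒜 = 𝒜})
  palindrome? w = w ≟ reverse w

  _∼_ : Rel (List 𝒜) a
  v ∼ w = v ≡ w ⊎ v ≡ reverse w

  _∼?_ : ∀ v w → Dec (v ∼ w)
  v ∼? w = (v ≟ w) ⊎-dec (v ≟ reverse w)

  ∼-sym : v ∼ w → w ∼ v
  ∼-sym (inj₁ eq)   = inj₁ (sym eq)
  ∼-sym (inj₂ refl) = inj₂ (sym (reverse-involutive _))

  ∼-trans : v ∼ w → w ∼ x → v ∼ x
  ∼-trans (inj₁ refl) w∼x         = w∼x
  ∼-trans (inj₂ eq)   (inj₁ refl) = inj₂ eq
  ∼-trans (inj₂ eq)   (inj₂ refl) = inj₁ (trans eq (reverse-involutive _))

  ∼-reverse : reverse v ∼ v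
  ∼-reverse = inj₂ refl

  palindrome-∼ : v ∼ w → Palindrome v → Palindrome w
  palindrome-∼ (inj₁ refl) pal = pal
  palindrome-∼ {w = w} (inj₂ refl) pal = trans (sym (reverse-involutive w)) (sym pal)

  -- Oriented words choose one word from each pair {w, reverse w} of distinct words.
  Oriented : Pred (List 𝒜) 0ℓ
  Oriented w = w ≺ reverse w

  Canonical : Pred (List 𝒜) a
  Canonical = Oriented ∪ Palindrome

  oriented? : Decidable Oriented
  oriented? w with compare w (reverse w)
  ... | tri< w≺ _ _ = yes w≺
  ... | tri≈ w⊀ _ _ = no w⊀
  ... | tri> w⊀ _ _ = no w⊀

  orient : ¬ Palindrome w → Oriented w ⊎ Oriented (reverse w)
  orient {w} ¬pal with compare w (reverse w)
  ... | tri< w≺ _ _  = inj₁ w≺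
  ... | tri≈ _ pal _ = contradiction pal ¬pal
  ... | tri> _ _ ≺w  = inj₂ (subst (reverse w ≺_) (sym (reverse-involutive w)) ≺w)

  oriented⇒¬palindrome : Oriented w → ¬ Palindrome w
  oriented⇒¬palindrome {w} w≺ pal = ≺-asym w≺ (subst₂ _≺_ pal (sym pal) w≺)

  oriented⇒¬oriented-reverse : Oriented w → ¬ Oriented (reverse w)
  oriented⇒¬oriented-reverse {w} w≺ ≺w = ≺-asym w≺ (subst (reverse w ≺_) (reverse-involutive w) ≺w)

  canonical-∼⇒≡ : Canonical v → Canonical w → v ∼ w → v ≡ w
  canonical-∼⇒≡ _          _          (inj₁ eq)   = eq
  canonical-∼⇒≡ (inj₁ ≺v)  (inj₁ ≺w)  (inj₂ refl) = contradiction ≺v (oriented⇒¬oriented-reverse ≺w)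
  canonical-∼⇒≡ _          (inj₂ pal) (inj₂ refl) = sym pal
  canonical-∼⇒≡ (inj₂ pal) _          (inj₂ refl) = trans pal (reverse-involutive _)

  -- Reversal exchanges the oriented words with those that are neither oriented nor palindromes.
  -- Hence `o + p` is the number of classes of `∼` in `P`, and each of the `o` classes without a
  -- palindrome counts twice in `n`.
  card-reversal : {P : Pred (List 𝒜) a} → (∀ {v} → P v → P (reverse v)) → P HasCard n →
    ∃[ o ] ∃[ p ] (P ∩ Oriented) HasCard o × (P ∩ Palindrome) HasCard p
      × (P ∩ Canonical) HasCard (o + p) × n ≡ o + (o + p)
  card-reversal {P = P} closed card =
    _ , _ , #o , #p , canonical ,
    card-unique split unsplit card
      (card-∪ disjoint (card-map reverse reverse-injective #o) canonical)
    where
    #o = proj₂ (card-filter oriented? card)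
    #p = proj₂ (card-filter palindrome? card)
    canonical = card-cong
      (λ { (inj₁ (Pv , o)) → Pv , inj₁ o ; (inj₂ (Pv , p)) → Pv , inj₂ p })
      (λ { (Pv , inj₁ o) → inj₁ (Pv , o) ; (Pv , inj₂ p) → inj₂ (Pv , p) })
      (card-∪ (λ (_ , o) (_ , p) → oriented⇒¬palindrome o p) #o #p)
    Reversed : Pred (List 𝒜) a
    Reversed w = ∃[ v ] (P ∩ Oriented) v × w ≡ reverse v
    split : P v → (Reversed ∪ (P ∩ Canonical)) v
    split {v} Pv with palindrome? v
    ... | yes pal = inj₂ (Pv , inj₂ pal)
    ... | no ¬pal with orient ¬pal
    ...   | inj₁ o = inj₂ (Pv , inj₁ o)
    ...   | inj₂ o = inj₁ (reverse v , (closed Pv , o) , sym (reverse-involutive v))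
    unsplit : (Reversed ∪ (P ∩ Canonical)) v → P v
    unsplit (inj₁ (_ , (Pv , _) , refl)) = closed Pv
    unsplit (inj₂ (Pv , _))              = Pv
    disjoint : Reversed v → (P ∩ Canonical) v → ⊥
    -- A canonical word in the class of the oriented `v` is `v` itself, so `v` would be a
    -- palindrome.
    disjoint (v , (_ , o) , refl) (_ , c) =
      oriented⇒¬palindrome o (sym (canonical-∼⇒≡ c (inj₁ o) ∼-reverse))

  -- The walk along `u` in the graph of factors.

  module Walk (u : ℕ → 𝒜) (N : ℕ) where

    -- At time `t` the walk crosses `edge t` from its prefix `vertex t` to its suffix
    -- `vertex (suc t)`.
    vertex edge : ℕ → List 𝒜
    vertex t = applyUpTo (λ j → u (t + j)) N
    edge   t = applyUpTo (λ j → u (t + j)) (suc N)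

    edge-∷ : ∀ t → edge t ≡ u t ∷ vertex (suc t)
    edge-∷ t = cong₂ _∷_ (cong u (+-identityʳ t)) (applyUpTo-cong N (λ j → cong u (+-suc t j)))

    edge-∷ʳ : ∀ t → edge t ≡ vertex t ∷ʳ u (t + N)
    edge-∷ʳ t = sym (applyUpTo-∷ʳ (λ j → u (t + j)) N)

    reverse-edge-∷ : ∀ t → reverse (edge t) ≡ u (t + N) ∷ reverse (vertex t)
    reverse-edge-∷ t = trans (cong reverse (edge-∷ʳ t)) (reverse-++ (vertex t) _)

    reverse-edge-∷ʳ : ∀ t → reverse (edge t) ≡ reverse (vertex (suc t)) ∷ʳ u t
    reverse-edge-∷ʳ t = trans (cong reverse (edge-∷ t)) (unfold-reverse (u t) (vertex (suc t)))

    edge-≡ : ∀ {s t} → edge s ≡ edge t → vertex (suc s) ≡ vertex (suc t)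
    edge-≡ {s} {t} eq = ∷-injectiveʳ (trans (sym (edge-∷ s)) (trans eq (edge-∷ t)))

    -- Reversal exchanges the two ends of an edge. The case of equal `s` and `t` shows that a
    -- palindromic edge is a loop.
    edge-≡-reverse : ∀ {s t} → edge s ≡ reverse (edge t) → vertex (suc s) ≡ reverse (vertex t)
    edge-≡-reverse {s} {t} eq = ∷-injectiveʳ (trans (sym (edge-∷ s)) (trans eq (reverse-edge-∷ t)))

    FirstVisit : List 𝒜 → ℕ → Set a
    FirstVisit v t = v ∼ vertex t × (∀ {i} → i < t → ¬ v ∼ vertex i)

    -- A connected graph has at least as many edges as vertices, up to one.  Here the graph
    -- is the one obtained by contracting the vertices named by SS to the starting point of
    -- the walk: a vertex outside is entered for the first time by a new edge, not a loop.
    walk-bound : ∀ {I : Set a} {κ ε m κ′} {V E K : Pred (List 𝒜) a} {SS : Pred I a} (name : I → List 𝒜) →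
      let S = λ v → ∃[ i ] SS i × v ∼ name i in
      V HasCard κ → (∀ {v w} → V v → V w → v ∼ w → v ≡ w) → (∀ {v} → V v → ∃[ t ] v ∼ vertex t) →
      SS HasCard m → S (vertex 0) →
      E HasCard ε → (∀ {e f} → E e → E f → e ∼ f → e ≡ f) →
      (∀ {e} → E e → ∃[ x ] ∃[ p ] ∃[ q ] ∃[ y ] e ≡ x ∷ q × e ≡ p ∷ʳ y × S p × S q) →
      K HasCard κ′ → (∀ {e} → E e → ∃[ f ] K f × f ∼ e) →
      (∀ t → ¬ Palindrome (edge t) → ∃[ f ] K f × f ∼ edge t) →
      κ + ε ≤ m + κ′
    walk-bound {I = I} {V = V} {E} {K} {SS} name
      #V V-canonical visited #SS start #E E-canonical ends #K K-E K-edge =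
      card-≤ (card-⊎ #V #E) (card-⊎ #SS #K) R total injective
      where
      S : Pred (List 𝒜) a
      S v = ∃[ i ] SS i × v ∼ name i

      S-∼ : v ∼ w → S w → S v
      S-∼ v∼w (i , SSi , w∼i) = i , SSi , ∼-trans v∼w w∼i

      S? : Decidable S
      S? v = card-any? #SS (λ i → v ∼? name i)

      -- The injection behind the inequality: a vertex of `S` goes to one of its names, any other
      -- vertex to the edge by which the walk first reaches it, and an edge of `E` to its
      -- representative in `K`.
      data R : List 𝒜 ⊎ List 𝒜 → I ⊎ List 𝒜 → Set a where
        inside  : ∀ {v i} → v ∼ name i → R (inj₁ v) (inj₁ i)
        entered : ∀ {v f t} → ¬ S v → FirstVisit v (suc t) → f ∼ edge t → R (inj₁ v) (inj₂ f)
        kept    : ∀ {e f} → f ∼ e → R (inj₂ e) (inj₂ f)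

      no-loop : ∀ {t} → FirstVisit v (suc t) → ¬ Palindrome (edge t)
      no-loop {t = t} (v∼ , first) pal =
        -- A loop ends where it starts, so `v` was already met at time `t`.
        first ≤-refl (∼-trans v∼ (inj₂ (edge-≡-reverse {t} {t} pal)))

      total : ∀ {x} → (V ⟨⊎⟩ E) x → ∃[ y ] (SS ⟨⊎⟩ K) y × R x y
      total {inj₂ e} Ee = let f , Kf , f∼e = K-E Ee in inj₂ f , Kf , kept f∼e
      total {inj₁ v} Vv with S? v
      ... | yes (i , SSi , v∼i) = inj₁ i , SSi , inside v∼i
      ... | no ¬Sv with least (λ t → v ∼? vertex t) (proj₂ (visited Vv))
      -- The walk starts in `S`, so a vertex outside has a step that first enters it.
      ...   | zero  , v∼ , _     = contradiction (S-∼ v∼ start) ¬Sv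
      ...   | suc t , v∼ , first =
        let f , Kf , f∼ = K-edge t (no-loop (v∼ , first)) in inj₂ f , Kf , entered ¬Sv (v∼ , first) f∼

      same-edge : ∀ {s t} → FirstVisit v (suc s) → FirstVisit w (suc t) → edge s ∼ edge t → v ∼ w
      same-edge {s = s} {t} (v∼ , _) (w∼ , _) (inj₁ eq) =
        ∼-trans v∼ (∼-trans (inj₁ (edge-≡ {s} {t} eq)) (∼-sym w∼))
      same-edge {v} {w} {s} {t} (v∼ , v-first) (w∼ , w-first) (inj₂ eq) =
        -- If one edge were crossed in opposite directions, `v` would be met at time `t` and `w` at
        -- time `s`, which forces both `s < t` and `t < s`.
        contradiction (later w-first w∼s) (<-asym (later v-first v∼t))
        where
        v∼t : v ∼ vertex t
        v∼t = ∼-trans v∼ (inj₂ (edge-≡-reverse {s} {t} eq))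
        w∼s : w ∼ vertex s
        w∼s = ∼-trans w∼ (inj₂ (edge-≡-reverse {t} {s} (trans (sym (reverse-involutive _)) (cong reverse (sym eq)))))
        later : ∀ {x i j} → (∀ {k} → k < suc i → ¬ x ∼ vertex k) → x ∼ vertex j → i < j
        later first x∼j = ≰⇒> λ j≤i → first (s≤s j≤i) x∼j

      edge-end : ∀ {e t} → E e → vertex (suc t) ∼ v → e ∼ edge t → S v
      edge-end {t = t} Ee ∼v e∼ with ends Ee | e∼
      -- The vertex reached is the suffix of `e`, or the reversal of its prefix if `e` is crossed
      -- backwards; `ends` puts both in `S`.
      ... | _ , _ , q , _ , e≡ , _ , _ , Sq | inj₁ eq =
        S-∼ (∼-trans (∼-sym ∼v) (inj₁ (∷-injectiveʳ (trans (sym (edge-∷ t)) (trans (sym eq) e≡))))) Sq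
      ... | _ , p , _ , _ , _ , e≡ , Sp , _ | inj₂ eq =
        S-∼ (∼-trans (∼-sym ∼v) (∼-trans (∼-sym ∼-reverse)
          (inj₁ (∷ʳ-injectiveˡ _ p (trans (sym (reverse-edge-∷ʳ t)) (trans (sym eq) e≡)))))) Sp

      injective : ∀ {x x′ y} → (V ⟨⊎⟩ E) x → (V ⟨⊎⟩ E) x′ → R x y → R x′ y → x ≡ x′
      injective Vv Vw (inside v∼i) (inside w∼i) = cong inj₁ (V-canonical Vv Vw (∼-trans v∼i (∼-sym w∼i)))
      injective Vv Vw (entered _ v-first f∼s) (entered _ w-first f∼t) =
        cong inj₁ (V-canonical Vv Vw (same-edge v-first w-first (∼-trans (∼-sym f∼s) f∼t)))
      injective Vv Ee (entered ¬Sv (v∼ , _) f∼t) (kept f∼e) =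
        contradiction (edge-end Ee (∼-sym v∼) (∼-trans (∼-sym f∼e) f∼t)) ¬Sv
      injective Ee Vv (kept f∼e) (entered ¬Sv (v∼ , _) f∼t) =
        contradiction (edge-end Ee (∼-sym v∼) (∼-trans (∼-sym f∼e) f∼t)) ¬Sv
      injective Ee Ef (kept f∼e) (kept f∼e′) = cong inj₂ (E-canonical Ee Ef (∼-trans (∼-sym f∼e) f∼e′))

-- Guarded and small cardinalities; the bilateral order in natural numbers.

guard : {A : Set a} → Dec A → ℕ → ℕ
guard (yes _) n = n
guard (no _)  n = 0

-- This turns a count over palindromes into a sum over all factors of the same length, with zero
-- terms at the others.
card-guard : ∀ {n} {A : Set ℓ₁} {P : Pred X ℓ} (A? : Dec A) → P HasCard n →
  (λ x → A × P x) HasCard guard A? n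
card-guard (yes A) card = card-cong (A ,_) proj₂ card
card-guard (no ¬A) card = [] , [] , (λ x → mk⇔ (λ ()) (λ (A , _) → contradiction A ¬A)) , refl

card-singleton : (x : X) → (λ y → y ≡ x) HasCard 1
card-singleton x = [ x ] , [] ∷ [] , (λ y → mk⇔ (λ { (here eq) → eq ; (there ()) }) here) , refl

card-0 : P HasCard 0 → ∀ {x} → ¬ P x
card-0 ([] , _ , xs⇔ , _) Px with () ← xs⇔ _ .from Px

card-1 : P HasCard 1 → ∀ {x y} → P x → P y → x ≡ y
card-1 (_ ∷ [] , _ , xs⇔ , _) Px Py with here refl ← xs⇔ _ .from Px | here refl ← xs⇔ _ .from Py = refl

-- Moving the subtracted terms across keeps the later counting in `ℕ`. For `p` equal to `1` the
-- integer on the left is `0ℤ`, so both conditions of the theorem are instances.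
bilateral : ∀ e r l p → e + 1 + 1 ≡ r + l + p ⇔ + p ℤ.- 1ℤ ≡ + e ℤ.- + r ℤ.- + l ℤ.+ 1ℤ
bilateral e r l p = mk⇔
  (λ eq → trans (expand (+ r) (+ l) (+ p))
    (trans (cong (λ n → + n ℤ.- + r ℤ.- + l ℤ.- 1ℤ) (sym eq)) (collect (+ e) (+ r) (+ l))))
  (λ eq → ℤ.+-injective (trans (expand′ (+ e) (+ r) (+ l))
    (trans (cong (λ z → z ℤ.+ (+ r ℤ.+ + l ℤ.+ 1ℤ)) (sym eq)) (collect′ (+ p) (+ r) (+ l)))))
  where
  expand : ∀ r l p → p ℤ.- 1ℤ ≡ r ℤ.+ l ℤ.+ p ℤ.- r ℤ.- l ℤ.- 1ℤ
  expand = ℤSolver.solve-∀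
  collect : ∀ e r l → e ℤ.+ 1ℤ ℤ.+ 1ℤ ℤ.- r ℤ.- l ℤ.- 1ℤ ≡ e ℤ.- r ℤ.- l ℤ.+ 1ℤ
  collect = ℤSolver.solve-∀
  expand′ : ∀ e r l → e ℤ.+ 1ℤ ℤ.+ 1ℤ ≡ e ℤ.- r ℤ.- l ℤ.+ 1ℤ ℤ.+ (r ℤ.+ l ℤ.+ 1ℤ)
  expand′ = ℤSolver.solve-∀
  collect′ : ∀ p r l → p ℤ.- 1ℤ ℤ.+ (r ℤ.+ l ℤ.+ 1ℤ) ≡ r ℤ.+ l ℤ.+ p
  collect′ = ℤSolver.solve-∀

-- Occurrences, extendability and recurrence.

module Occurrences {𝒜 : Set a} (u : ℕ → 𝒜) where

  OccursAt : ℕ → List 𝒜 → Set a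
  OccursAt i w = applyUpTo (λ j → u (i + j)) (length w) ≡ w

  occurs-factor : ∀ i n → OccursAt i (applyUpTo (λ j → u (i + j)) n)
  occurs-factor i n = cong (applyUpTo _) (length-applyUpTo _ n)

  occurs-++ : ∀ {i} v {w} → OccursAt i (v ++ w) ⇔ (OccursAt i v × OccursAt (i + length v) w)
  occurs-++ {i} [] {w} = mk⇔ (λ occ → refl , subst (λ i → OccursAt i w) (sym (+-identityʳ i)) occ)
                             (λ (_ , occ) → subst (λ i → OccursAt i w) (+-identityʳ i) occ)
  occurs-++ {i} (x ∷ v) {w} = mk⇔
    (λ occ → let hd , tl = ∷-injective occ
                 occ-v , occ-w = occurs-++ v .to (trans (sym (shift (v ++ w))) tl)
             in cong₂ _∷_ hd (trans (shift v) occ-v) , subst (λ i → OccursAt i w) (sym (+-suc i _)) occ-w)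
    (λ (occ-xv , occ-w) → let hd , tl = ∷-injective occ-xv in
       cong₂ _∷_ hd (trans (shift (v ++ w))
         (occurs-++ v .from (trans (sym (shift v)) tl , subst (λ i → OccursAt i w) (+-suc i _) occ-w))))
    where
    shift : ∀ v → applyUpTo (λ j → u (i + suc j)) (length v) ≡ applyUpTo (λ j → u (suc i + j)) (length v)
    shift v = applyUpTo-cong (length v) (λ j → cong u (+-suc i j))

  ℒ-init : ∀ {w y} → ℒ u (w ∷ʳ y) → ℒ u w
  ℒ-init {w} (i , occ) = i , proj₁ (occurs-++ w .to occ)

  ℒ-tail : ∀ {x w} → ℒ u (x ∷ w) → ℒ u w
  ℒ-tail {x} (i , occ) = i + 1 , proj₂ (occurs-++ [ x ] .to occ)

  ℒ-extendʳ : ∀ {w} → ℒ u w → ∃[ y ] ℒ u (w ∷ʳ y)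
  ℒ-extendʳ {w} (i , occ) = u (i + length w + 0) , i , occurs-++ w .from (occ , refl)

  module _ (closed : ClosedUnderReversal u) where

    ℒ-reverse : ∀ {w} → ℒ u (reverse w) → ℒ u w
    ℒ-reverse {w} Lw = subst (ℒ u) (reverse-involutive w) (closed _ Lw)

    -- An occurrence at position 0 has no letter before it, so the left letter is obtained from a
    -- right extension of `reverse w`.
    ℒ-extendˡ : ∀ {w} → ℒ u w → ∃[ x ] ℒ u (x ∷ w)
    ℒ-extendˡ {w} Lw = let x , Lxw = ℒ-extendʳ (closed w Lw) in
      x , ℒ-reverse (subst (ℒ u) (sym (unfold-reverse x w)) Lxw)

    -- In the reversal of a prefix of u in which w is followed by i letters, reverse w is
    -- preceded by i letters.
    recurrent : ∀ {w} → ℒ u w → ∀ i → ∃[ t ] OccursAt (i + t) (reverse w)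
    recurrent {w} (j , occ) i =
      proj₁ rev-occurs , subst (λ n → OccursAt n (reverse w)) position
        (proj₂ (occurs-++ (reverse z) .to (proj₁ (occurs-++ (reverse z ++ reverse w) .to (proj₂ rev-occurs)))))
      where
      x z : List 𝒜
      x = applyUpTo u j
      z = applyUpTo (λ t → u (j + length w + t)) i
      Lxwz : ℒ u (x ++ w ++ z)
      Lxwz = 0 , occurs-++ x .from (occurs-factor 0 j ,
        subst (λ n → OccursAt n (w ++ z)) (sym (length-applyUpTo u j))
          (occurs-++ w .from (occ , occurs-factor (j + length w) i)))
      reversed : reverse (x ++ w ++ z) ≡ (reverse z ++ reverse w) ++ reverse x
      reversed = trans (reverse-++ x (w ++ z)) (cong (_++ reverse x) (reverse-++ w z))
      rev-occurs : ℒ u ((reverse z ++ reverse w) ++ reverse x)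
      rev-occurs = subst (ℒ u) reversed (closed _ Lxwz)
      position : proj₁ rev-occurs + length (reverse z) ≡ i + proj₁ rev-occurs
      position = trans (cong (λ n → proj₁ rev-occurs + n) (trans (length-reverse z) (length-applyUpTo _ i)))
        (+-comm (proj₁ rev-occurs) i)

-- Two-sided extensions of a word.

reverse-extension : {𝒜 : Set a} (x : 𝒜) (w : List 𝒜) (y : 𝒜) →
  reverse (x ∷ w ∷ʳ y) ≡ y ∷ reverse w ∷ʳ x
reverse-extension x w y = trans (unfold-reverse x (w ∷ʳ y)) (cong (_∷ʳ x) (reverse-++ w [ y ]))

extension-injective : {𝒜 : Set a} {x x′ y y′ : 𝒜} {w w′ : List 𝒜} →
  x ∷ w ∷ʳ y ≡ x′ ∷ w′ ∷ʳ y′ → x ≡ x′ × w ≡ w′ × y ≡ y′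
extension-injective {w = w} {w′} eq =
  let x≡ , eq′ = ∷-injective eq ; w≡ , y≡ = ∷ʳ-injective w w′ eq′ in x≡ , w≡ , y≡

extension-∷ʳ : {𝒜 : Set a} (w : List 𝒜) (y : 𝒜) → ∃[ x ] ∃[ v ] w ∷ʳ y ≡ x ∷ v
extension-∷ʳ []      y = y , [] , refl
extension-∷ʳ (x ∷ w) y = x , w ∷ʳ y , refl

length-∷ʳ : {𝒜 : Set a} (w : List 𝒜) (y : 𝒜) → length (w ∷ʳ y) ≡ suc (length w)
length-∷ʳ w y = trans (length-++ w) (+-comm (length w) 1)

length-extension : {𝒜 : Set a} (x : 𝒜) (w : List 𝒜) (y : 𝒜) → length (x ∷ w ∷ʳ y) ≡ 2 + length w
length-extension x w y = cong suc (length-∷ʳ w y)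

-- Decidability and finite counts in the language of `u`.

module Languages {𝒜 : Set a} (k : ℕ) (𝒜↔Fin : 𝒜 ↔ Fin k) (u : ℕ → 𝒜) (closed : ClosedUnderReversal u)
  (complexity : ∀ n → 𝒞⟨ u ⟩[ n ]≡ (k ∸ 1) * n + 1) where

  open Occurrences u

  private
    code : 𝒜 → Fin k
    code = Inverse.to 𝒜↔Fin
    code-injective : ∀ {x y} → code x ≡ code y → x ≡ y
    code-injective = Injection.injective (Inverse⇒Injection 𝒜↔Fin)
    variable
      v w : List 𝒜

  -- This order serves to decide equality of words and to choose between a word and its reversal.
  _≺_ : Rel (List 𝒜) 0ℓ
  v ≺ w = Lex-< _≡_ Fin._<_ (map code v) (map code w)

  ≺-compare : Trichotomous _≡_ _≺_
  ≺-compare v w with <-compare sym Fin.<-cmp (map code v) (map code w)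
  ... | tri< v≺w v≢w w⊀v = tri< v≺w (λ { refl → v≢w (≡⇒Pointwise-≡ refl) }) w⊀v
  ... | tri≈ v⊀w v≡w w⊀v = tri≈ v⊀w (map-injective code-injective (Pointwise-≡⇒≡ v≡w)) w⊀v
  ... | tri> v⊀w v≢w w≺v = tri> v⊀w (λ { refl → v≢w (≡⇒Pointwise-≡ refl) }) w≺v

  open Reversal ≺-compare

  letters : (U {A = 𝒜}) HasCard k
  letters = map (Inverse.from 𝒜↔Fin) (allFin k) ,
    Unique.map⁺ (Injection.injective (Inverse⇒Injection (↔-sym 𝒜↔Fin))) (Unique.allFin⁺ k) ,
    (λ x → mk⇔ (λ _ → tt)
      (λ _ → subst (_∈ _) (Inverse.strictlyInverseʳ 𝒜↔Fin x) (∈-map⁺ _ (∈-allFin (code x))))) ,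
    trans (length-map _ (allFin k)) (length-tabulate id)

  abstract

    -- A search over positions need not end, but `complexity` lists all factors of each length.
    ℒ? : Decidable (ℒ u)
    ℒ? w = map′ (λ { (_ , (Lw , _) , refl) → Lw }) (λ Lw → w , (Lw , refl) , refl)
      (card-any? (complexity (length w)) (w ≟_))

    card-letters : {P : Pred 𝒜 ℓ} → Decidable P → ∃[ n ] P HasCard n
    card-letters P? = let n , card = card-filter P? letters in n , card-cong proj₂ (tt ,_) card

    #Lext : ∀ w → ∃[ l ] Lext u w HasCard l
    #Lext w = card-letters (λ x → ℒ? (x ∷ w))

    #Rext : ∀ w → ∃[ r ] Rext u w HasCard r
    #Rext w = card-letters (λ y → ℒ? (w ∷ʳ y))

    #Bext : ∀ w → ∃[ b ] Bext u w HasCard b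
    #Bext w = _ , card-cong
      (λ { ((x , y) , (_ , Lv) , refl) → Lv , x , y , refl })
      (λ { (Lv , x , y , refl) → (x , y) , (_ , Lv) , refl })
      (card-map (λ (x , y) → x ∷ w ∷ʳ y)
        (λ eq → let x≡ , _ , y≡ = extension-injective eq in cong₂ _,_ x≡ y≡)
        (proj₂ (card-filter (λ (x , y) → ℒ? (x ∷ w ∷ʳ y)) (proj₂ (card-× letters letters)))))

    #Pext : ∀ w → ∃[ p ] Pext u w HasCard p
    #Pext w = _ , card-cong
      (λ { (x , Lv , refl) → Lv , x , refl })
      (λ { (Lv , x , refl) → x , Lv , refl })
      (card-map (λ x → x ∷ w ∷ʳ x) ∷-injectiveˡ (proj₂ (card-letters (λ x → ℒ? (x ∷ w ∷ʳ x)))))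

    #𝒫 : ∀ n → ∃[ p ] 𝒫⟨ u ⟩[ n ]≡ p
    #𝒫 n = card-filter palindrome? (complexity n)

  l r b p : List 𝒜 → ℕ
  l w = proj₁ (#Lext w)
  r w = proj₁ (#Rext w)
  b w = proj₁ (#Bext w)
  p w = proj₁ (#Pext w)

  𝒫 : ℕ → ℕ
  𝒫 n = proj₁ (#𝒫 n)

  -- The tree inequality.

  factor-reverse : FactorOfLength u n v → FactorOfLength u n (reverse v)
  factor-reverse {v = v} (Lv , len) = closed v Lv , trans (length-reverse v) len

  orient-factor : FactorOfLength u n v → ¬ Palindrome v → ∃[ w ] (FactorOfLength u n ∩ Oriented) w × w ∼ v
  orient-factor {v = v} Fv ¬pal with orient ¬pal
  ... | inj₁ o = v , (Fv , o) , inj₁ refl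
  ... | inj₂ o = reverse v , (factor-reverse Fv , o) , ∼-reverse

  -- When 𝒫 n + 𝒫 (n + 1) = k + 1, the graph of the factors of length n up to reversal has
  -- exactly one vertex more than it has edges that are not loops, so it is a tree.  Hence any
  -- m of its vertices span less than m edges.
  tree-bound : ∀ {n m ε} {I : Set a} {SS : Pred I a} {E : Pred (List 𝒜) a} (name : I → List 𝒜) →
    let S = λ v → ∃[ i ] SS i × v ∼ name i in
    𝒫 n + 𝒫 (suc n) ≡ k + 1 →
    SS HasCard m → (∃[ i ] SS i × FactorOfLength u n (name i)) →
    E HasCard ε → (∀ {e f} → E e → E f → e ∼ f → e ≡ f) →
    (∀ {e} → E e → FactorOfLength u (suc n) e × ¬ Palindrome e) →
    (∀ {e} → E e → ∃[ x ] ∃[ p ] ∃[ q ] ∃[ y ] e ≡ x ∷ q × e ≡ p ∷ʳ y × S p × S q) →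
    suc ε ≤ m
  tree-bound {n} {m} {ε} name 𝒫-sum #SS (s , SSs , (i , occ) , len) #E E-canonical E-factor ends
    with card-reversal factor-reverse (complexity n) | card-reversal factor-reverse (complexity (suc n))
  ... | o , p , _ , #p , #c , C≡ | o′ , p′ , #o′ , #p′ , _ , C′≡ =
    -- The letter `u 0` shows that `k` is positive, so `k ∸ 1` is a true predecessor.
    count k (code (u 0))
      (subst₂ (λ p p′ → p + p′ ≡ k + 1)
        (card-unique id id (proj₂ (#𝒫 n)) #p) (card-unique id id (proj₂ (#𝒫 (suc n))) #p′) 𝒫-sum)
      C≡ C′≡
      -- The vertices are the canonical factors of length `n`; the edges that are not loops are the
      -- oriented factors of length `suc n`.
      (walk-bound name #c (λ (_ , cv) (_ , cw) → canonical-∼⇒≡ cv cw) visited #SS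
        (s , SSs , inj₁ (subst (λ l → applyUpTo (λ j → u (i + j)) l ≡ name s) len occ))
        #E E-canonical ends #o′
        (λ Ee → let Fe , ¬pal = E-factor Ee in orient-factor Fe ¬pal)
        (λ t ¬pal → orient-factor (factor-at t) ¬pal))
    where
    -- Reading `u` from an occurrence of `name s` makes the walk start inside the subgraph.
    open Walk (λ j → u (i + j)) n

    visited : (FactorOfLength u n ∩ Canonical) v → ∃[ t ] v ∼ vertex t
    -- Recurrence supplies `reverse v` at some position from `i` on, which suffices up to `∼`.
    visited {v} ((Lv , refl) , _) = let t , occ = recurrent closed Lv i in
      t , ∼-sym (inj₂ (trans (applyUpTo-cong n (λ j → cong u (sym (+-assoc i t j))))
        (subst (λ l → applyUpTo (λ j → u (i + t + j)) l ≡ reverse v) (length-reverse v) occ)))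

    length-edge : ∀ t → length (edge t) ≡ suc n
    length-edge t = length-applyUpTo (λ j → u (i + (t + j))) (suc n)

    factor-at : ∀ t → FactorOfLength u (suc n) (edge t)
    factor-at t = (i + t , occurs) , length-edge t
      where
      occurs : OccursAt (i + t) (edge t)
      occurs = trans (cong (applyUpTo (λ j → u (i + t + j))) (length-edge t))
        (applyUpTo-cong (suc n) (λ j → cong u (+-assoc i t j)))

    count : ∀ k → Fin k → ∀ {o p o′ p′} → p + p′ ≡ k + 1 →
      (k ∸ 1) * n + 1 ≡ o + (o + p) → (k ∸ 1) * suc n + 1 ≡ o′ + (o′ + p′) →
      o + p + ε ≤ m + o′ → suc ε ≤ m
    count (suc k) _ {o} {p} {o′} {p′} p+p′ C≡ C′≡ bound =
      +-cancelʳ-≤ o′ (suc ε) m (≤-trans (≤-reflexive rearranged) bound)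
      where
      -- Twice the tree identity `suc o′ ≡ o + p`; the factor 2 arises because the complexities
      -- count both orientations.
      double : suc o′ + suc o′ + (k + p′) ≡ o + p + (o + p) + (k + p′)
      double = begin
        suc o′ + suc o′ + (k + p′)  ≡⟨ lemma₁ o′ k p′ ⟩
        o′ + (o′ + p′) + (k + 2)    ≡⟨ cong (_+ (k + 2)) (sym C′≡) ⟩
        k * suc n + 1 + (k + 2)     ≡⟨ lemma₂ k n ⟩
        k * n + 1 + k + (suc k + 1) ≡⟨ cong₂ (λ c s → c + k + s) C≡ (sym p+p′) ⟩
        o + (o + p) + k + (p + p′)  ≡⟨ lemma₃ o p k p′ ⟩
        o + p + (o + p) + (k + p′)  ∎
        where
        open ≡-Reasoning
        lemma₁ : ∀ o′ k p′ → suc o′ + suc o′ + (k + p′) ≡ o′ + (o′ + p′) + (k + 2)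
        lemma₁ = solve-∀
        lemma₂ : ∀ k n → k * suc n + 1 + (k + 2) ≡ k * n + 1 + k + (suc k + 1)
        lemma₂ = solve-∀
        lemma₃ : ∀ o p k p′ → o + (o + p) + k + (p + p′) ≡ o + p + (o + p) + (k + p′)
        lemma₃ = solve-∀
      halve : ∀ {x y} → x + x ≡ y + y → x ≡ y
      halve {x} {y} eq = *-cancelˡ-≡ x y 2 (trans (twice x) (trans eq (sym (twice y))))
        where
        twice : ∀ x → 2 * x ≡ x + x
        twice = solve-∀
      rearranged : suc ε + o′ ≡ o + p + ε
      rearranged = trans (cong suc (+-comm ε o′))
        (cong (_+ ε) (halve {suc o′} {o + p} (+-cancelʳ-≡ (k + p′) _ _ double)))

  -- Upper bounds on the bilateral order.

  Lext⇔Rext : Palindrome w → ∀ {x} → Lext u w x ⇔ Rext u w x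
  Lext⇔Rext {w} pal {x} = mk⇔
    (λ Lxw → subst (ℒ u) reversed (closed _ Lxw))
    (λ Lwx → ℒ-reverse closed (subst (ℒ u) (sym reversed) Lwx))
    where
    reversed : reverse (x ∷ w) ≡ w ∷ʳ x
    reversed = trans (unfold-reverse x w) (cong (_∷ʳ x) (sym pal))

  l≡r : Palindrome w → l w ≡ r w
  l≡r {w} pal = card-unique (Lext⇔Rext pal .to) (Lext⇔Rext pal .from) (proj₂ (#Lext w)) (proj₂ (#Rext w))

  palindrome-extension : ∀ {x y} → Palindrome (x ∷ w ∷ʳ y) → x ≡ y × Palindrome w
  palindrome-extension {w} {x} {y} pal =
    let x≡y , pal-w , _ = extension-injective (trans pal (reverse-extension x w y)) in x≡y , pal-w

  -- The edges `x ∷ w ∷ʳ y` join `x ∷ w` to `w ∷ʳ y`, and `tree-bound` applies to this subgraph. If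
  -- `w` is not a palindrome, it has `b w` edges and `l w + r w` named vertices. If `w` is a
  -- palindrome, reversal identifies the two kinds of vertices and pairs off the edges that are not
  -- loops.
  bilateral-bound : ∀ {n} → 𝒫 (suc n) + 𝒫 (suc (suc n)) ≡ k + 1 → ℒ u w → length w ≡ n →
    (¬ Palindrome w → b w + 1 ≤ r w + l w) × (Palindrome w → b w + 1 + 1 ≤ r w + l w + p w)
  bilateral-bound {w} 𝒫-sum Lw refl = nonpalindrome , palindrome
    where
    left-start : ∃[ x ] Lext u w x × FactorOfLength u (suc (length w)) (x ∷ w)
    left-start = let x , Lxw = ℒ-extendˡ closed Lw in x , Lxw , Lxw , refl

    nonpalindrome : ¬ Palindrome w → b w + 1 ≤ r w + l w
    nonpalindrome ¬pal = ≤-trans (≤-reflexive (+-comm (b w) 1))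
      (≤-trans (tree-bound name 𝒫-sum (card-⊎ (proj₂ (#Lext w)) (proj₂ (#Rext w)))
                 (let x , start = left-start in inj₁ x , start)
                 (proj₂ (#Bext w)) canonical factor ends)
               (≤-reflexive (+-comm (l w) (r w))))
      where
      name : 𝒜 ⊎ 𝒜 → List 𝒜
      name = [ _∷ w , w ∷ʳ_ ]′
      canonical : ∀ {e f} → Bext u w e → Bext u w f → e ∼ f → e ≡ f
      canonical _ _ (inj₁ e≡f) = e≡f
      canonical (_ , x , y , refl) (_ , x′ , y′ , refl) (inj₂ eq) =
        -- Reversing an extension of `w` gives an extension of `reverse w`, so two extensions of a
        -- non-palindrome are never reversals of each other.
        contradiction (proj₁ (proj₂ (extension-injective (trans eq (reverse-extension x′ w y′))))) ¬pal
      factor : ∀ {e} → Bext u w e → FactorOfLength u (2 + length w) e × ¬ Palindrome e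
      factor (Le , x , y , refl) = (Le , length-extension x w y) , ¬pal ∘ proj₂ ∘ palindrome-extension
      ends : ∀ {e} → Bext u w e → _
      ends (Le , x , y , refl) = x , x ∷ w , w ∷ʳ y , y , refl , refl ,
        (inj₁ x , ℒ-init Le , inj₁ refl) , (inj₂ y , ℒ-tail Le , inj₁ refl)

    palindrome : Palindrome w → b w + 1 + 1 ≤ r w + l w + p w
    -- Reversal permutes the extensions of a palindrome, and its fixed points are those counted by
    -- `p w`.
    palindrome pal with card-reversal closed′ (proj₂ (#Bext w))
      where
      closed′ : Bext u w v → Bext u w (reverse v)
      closed′ (Lv , x , y , refl) = closed _ Lv , y , x ,
        trans (reverse-extension x w y) (cong (λ w → y ∷ w ∷ʳ x) (sym pal))
    ... | o , q , #o , #q , _ , b≡ = begin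
      b w + 1 + 1           ≡⟨ cong (λ b → b + 1 + 1) b≡ ⟩
      o + (o + q) + 1 + 1   ≡⟨ lemma o q ⟩
      suc o + suc o + q     ≤⟨ +-mono-≤ (+-mono-≤ bound bound) (≤-reflexive q≡p) ⟩
      l w + l w + p w       ≡⟨ cong (λ r → r + l w + p w) (l≡r pal) ⟩
      r w + l w + p w       ∎
      where
      open ≤-Reasoning
      lemma : ∀ o q → o + (o + q) + 1 + 1 ≡ suc o + suc o + q
      lemma = solve-∀
      q≡p : q ≡ p w
      q≡p = card-unique
        (λ { ((Lv , x , y , refl) , pal-v) →
           case palindrome-extension pal-v of λ { (refl , _) → Lv , x , refl } })
        (λ { (Lv , x , refl) → (Lv , x , x , refl) ,
           trans (cong (λ w → x ∷ w ∷ʳ x) pal) (sym (reverse-extension x w x)) })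
        #q (proj₂ (#Pext w))
      -- Since `w ∷ʳ y` is the reversal of `y ∷ w`, the left extensions name all the vertices.
      bound : suc o ≤ l w
      bound = tree-bound (_∷ w) 𝒫-sum (proj₂ (#Lext w)) left-start #o
        (λ (_ , oe) (_ , of) → canonical-∼⇒≡ (inj₁ oe) (inj₁ of))
        (λ { ((Le , x , y , refl) , o) → (Le , length-extension x w y) , oriented⇒¬palindrome o })
        (λ { ((Le , x , y , refl) , _) → x , x ∷ w , w ∷ʳ y , y , refl , refl ,
           (x , ℒ-init Le , inj₁ refl) ,
           (y , Lext⇔Rext pal .from (ℒ-tail Le) ,
             inj₂ (sym (trans (unfold-reverse y w) (cong (_∷ʳ y) (sym pal))))) })

  -- Summation over the factors of a given length.

  factors : ℕ → List (List 𝒜)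
  factors n = proj₁ (complexity n)

  ∈-factors : v ∈ factors n ⇔ FactorOfLength u n v
  ∈-factors {v} {n} = let _ , _ , factors⇔ , _ = complexity n in factors⇔ v

  -- Double counting: the sets `Q w`, for `w` a factor of length `n`, partition `P`.
  sum-fibres : ∀ {n m} {P : Pred (List 𝒜) a} {Q : List 𝒜 → Pred (List 𝒜) a} {c : List 𝒜 → ℕ} →
    (∀ w → Q w HasCard c w) → (∀ {w w′ v} → Q w v → Q w′ v → w ≡ w′) →
    (∀ {w v} → FactorOfLength u n w → Q w v → P v) → (∀ {v} → P v → ∃[ w ] FactorOfLength u n w × Q w v) →
    P HasCard m → sum (map c (factors n)) ≡ m
  sum-fibres {n} card functional sound complete #P = let _ , factors! , _ = complexity n in
    card-unique (λ (w , w∈ , Qwv) → sound (∈-factors .to w∈) Qwv)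
      (λ Pv → let w , Fw , Qwv = complete Pv in w , ∈-factors .from Fw , Qwv)
      (card-fibres card functional factors!) #P

  decompose : FactorOfLength u (2 + n) v → ∃[ x ] ∃[ w ] ∃[ y ] v ≡ x ∷ w ∷ʳ y × FactorOfLength u n w
  decompose {v = x ∷ v} (Lv , len) with initLast v
  decompose {v = x ∷ .[]} (Lv , ()) | []
  ... | w ∷ʳ′ y = x , w , y , refl , ℒ-init (ℒ-tail Lv) ,
    suc-injective (suc-injective (trans (sym (length-extension x w y)) len))

  -- left w ≡ right w is the condition on b(w) with all subtracted terms moved to the other side.
  left right : List 𝒜 → ℕ
  left  w = b w + 1 + guard (palindrome? w) 1
  right w = r w + l w + guard (palindrome? w) (p w)

  -- Factors of length `2 + n` are sorted by their middle part; the constant terms count the factors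
  -- and the palindromes of length `n`.
  sum-left : ∀ n → sum (map left (factors n)) ≡ (k ∸ 1) * (2 + n) + 1 + ((k ∸ 1) * n + 1) + 𝒫 n
  sum-left n = trans (sum-+ _ _ (factors n)) (cong₂ _+_ (trans (sum-+ _ _ (factors n)) (cong₂ _+_
      (sum-fibres (λ w → proj₂ (#Bext w))
        (λ { (_ , x , y , eq) (_ , x′ , y′ , eq′) → proj₁ (proj₂ (extension-injective (trans (sym eq) eq′))) })
        (λ { {w} (_ , refl) (Lv , x , y , refl) → Lv , length-extension x w y })
        (λ { (Lv , len) → let x , w , y , eq , Fw = decompose (Lv , len) in w , Fw , Lv , x , y , eq })
        (complexity (2 + n)))
      (sum-fibres card-singleton (λ { refl eq → eq }) (λ { Fw refl → Fw }) (λ Fv → _ , Fv , refl) (complexity n))))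
    (sum-fibres (λ w → card-guard (palindrome? w) (card-singleton w)) (λ { (_ , refl) (_ , eq) → eq })
      (λ { Fw (pal , refl) → Fw , pal }) (λ (Fv , pal) → _ , Fv , pal , refl) (proj₂ (#𝒫 n))))

  -- Factors of length `suc n` are counted twice, by prefix and by suffix, and the palindromes of
  -- length `2 + n` by their centre.
  sum-right : ∀ n → sum (map right (factors n)) ≡ (k ∸ 1) * suc n + 1 + ((k ∸ 1) * suc n + 1) + 𝒫 (2 + n)
  sum-right n = trans (sum-+ _ _ (factors n)) (cong₂ _+_ (trans (sum-+ _ _ (factors n)) (cong₂ _+_
      (sum-fibres (λ w → card-map (w ∷ʳ_) (∷ʳ-injectiveʳ w w) (proj₂ (#Rext w)))
        (λ { {w} {w′} (_ , _ , eq) (_ , _ , eq′) → ∷ʳ-injectiveˡ w w′ (trans (sym eq) eq′) })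
        (λ { {w} (_ , refl) (y , Lv , refl) → Lv , length-∷ʳ w y })
        last (complexity (suc n)))
      (sum-fibres (λ w → card-map (_∷ w) ∷-injectiveˡ (proj₂ (#Lext w)))
        (λ { (_ , _ , eq) (_ , _ , eq′) → ∷-injectiveʳ (trans (sym eq) eq′) })
        (λ { (_ , refl) (x , Lv , refl) → Lv , refl })
        (λ { {x ∷ w} (Lv , refl) → w , (ℒ-tail Lv , refl) , x , Lv , refl })
        (complexity (suc n)))))
    (sum-fibres (λ w → card-guard (palindrome? w) (proj₂ (#Pext w)))
      (λ { (_ , _ , x , eq) (_ , _ , x′ , eq′) → proj₁ (proj₂ (extension-injective (trans (sym eq) eq′))) })
      (λ { {w} (_ , refl) (pal , Lv , x , refl) → (Lv , length-extension x w x) ,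
           trans (cong (λ w → x ∷ w ∷ʳ x) pal) (sym (reverse-extension x w x)) })
      centre (proj₂ (#𝒫 (2 + n)))))
    where
    last : FactorOfLength u (suc n) v → ∃[ w ] FactorOfLength u n w × ∃[ y ] Rext u w y × v ≡ w ∷ʳ y
    last {v} (Lv , len) with initLast v
    last (Lv , ()) | []
    ... | w ∷ʳ′ y = w , (ℒ-init Lv , suc-injective (trans (sym (length-∷ʳ w y)) len)) , y , Lv , refl
    centre : PalindromicFactorOfLength u (2 + n) v → ∃[ w ] FactorOfLength u n w × Palindrome w × Pext u w v
    centre (Fv , pal) with decompose Fv
    ... | x , w , y , refl , Fw with palindrome-extension pal
    ...   | refl , pal-w = w , Fw , pal-w , proj₁ Fv , x , refl

  -- The second difference of the complexity vanishes.
  sum-difference : ∀ n → sum (map left (factors n)) + 𝒫 (2 + n) ≡ sum (map right (factors n)) + 𝒫 n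
  sum-difference n = trans (cong (_+ 𝒫 (2 + n)) (sum-left n))
    (trans (lemma (k ∸ 1) n (𝒫 n) (𝒫 (2 + n))) (cong (_+ 𝒫 n) (sym (sum-right n))))
    where
    lemma : ∀ k n p q → k * (2 + n) + 1 + (k * n + 1) + p + q ≡ k * suc n + 1 + (k * suc n + 1) + q + p
    lemma = solve-∀

  Balanced : Pred (List 𝒜) a
  Balanced w = (¬ Palindrome w → b w + 1 ≡ r w + l w) × (Palindrome w → b w + 1 + 1 ≡ r w + l w + p w)

  left≡right⇔ : ∀ w → left w ≡ right w ⇔ Balanced w
  left≡right⇔ w with palindrome? w
  ... | yes pal = mk⇔ (λ eq → (λ ¬pal → contradiction pal ¬pal) , λ _ → eq) (λ (_ , eq) → eq pal)
  ... | no ¬pal = mk⇔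
    (λ eq → (λ _ → +-cancelʳ-≡ 0 _ _ eq) , λ pal → contradiction pal ¬pal)
    (λ (eq , _) → cong (_+ 0) (eq ¬pal))

  left≤right : ∀ n → 𝒫 (suc n) + 𝒫 (2 + n) ≡ k + 1 → FactorOfLength u n w → left w ≤ right w
  left≤right {w} n 𝒫-sum (Lw , len) with palindrome? w | bilateral-bound 𝒫-sum Lw len
  ... | yes pal | _ , bound = bound pal
  ... | no ¬pal | bound , _ = +-monoˡ-≤ 0 (bound ¬pal)

  -- Two consecutive instances of the hypothesis give equal palindrome counts at `n` and `2 + n`, so
  -- the two sums agree and no termwise bound is strict.
  left≡right : (∀ n → 𝒫 n + 𝒫 (suc n) ≡ k + 1) → FactorOfLength u n w → left w ≡ right w
  left≡right {n} 𝒫-sum Fw = sum-≡⇒≡ (factors n) (left≤right n (𝒫-sum (suc n)) ∘ ∈-factors .to)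
    (+-cancelʳ-≡ (𝒫 n) _ _ (trans (cong (λ m → sum (map left (factors n)) + m) 𝒫≡) (sum-difference n)))
    (∈-factors .from Fw)
    where
    𝒫≡ : 𝒫 n ≡ 𝒫 (2 + n)
    𝒫≡ = +-cancelʳ-≡ (𝒫 (suc n)) _ _ (trans (𝒫-sum n) (trans (sym (𝒫-sum (suc n))) (+-comm (𝒫 (suc n)) _)))

  -- Factors that are not bispecial.

  b≡r : l w ≡ 1 → b w ≡ r w
  b≡r {w} l≡1 = ≤-antisym
    (card-≤ (proj₂ (#Bext w)) (proj₂ (#Rext w)) (λ v y → ∃[ x ] v ≡ x ∷ w ∷ʳ y)
      (λ { (Lv , x , y , eq) → y , ℒ-tail (subst (ℒ u) eq Lv) , x , eq })
      -- Only one letter can stand to the left of `w`, so `y` determines the extension.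
      (λ { (Lv , _) (Lv′ , _) (x , refl) (x′ , refl) →
        cong (λ x → x ∷ w ∷ʳ _) (card-1 #l (ℒ-init Lv) (ℒ-init Lv′)) }))
    (card-≤ (proj₂ (#Rext w)) (proj₂ (#Bext w)) (λ y v → ∃[ x ] v ≡ x ∷ w ∷ʳ y)
      (λ {y} Ly → let x , Lv = ℒ-extendˡ closed Ly in x ∷ w ∷ʳ y , (Lv , x , y , refl) , x , refl)
      (λ { _ _ (x , eq) (x′ , eq′) → proj₂ (proj₂ (extension-injective (trans (sym eq) eq′))) }))
    where
    #l : Lext u w HasCard 1
    #l = subst (Lext u w HasCard_) l≡1 (proj₂ (#Lext w))

  b≡l : r w ≡ 1 → b w ≡ l w
  b≡l {w} r≡1 = ≤-antisym
    (card-≤ (proj₂ (#Bext w)) (proj₂ (#Lext w)) (λ v x → ∃[ y ] v ≡ x ∷ w ∷ʳ y)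
      (λ { (Lv , x , y , eq) → x , ℒ-init (subst (ℒ u) eq Lv) , y , eq })
      (λ { (Lv , _) (Lv′ , _) (y , refl) (y′ , refl) →
        cong (λ y → _ ∷ w ∷ʳ y) (card-1 #r (ℒ-tail Lv) (ℒ-tail Lv′)) }))
    (card-≤ (proj₂ (#Lext w)) (proj₂ (#Bext w)) (λ x v → ∃[ y ] v ≡ x ∷ w ∷ʳ y)
      (λ {x} Lx → let y , Lv = ℒ-extendʳ Lx in x ∷ w ∷ʳ y , (Lv , x , y , refl) , y , refl)
      (λ { _ _ (y , eq) (y′ , eq′) → proj₁ (extension-injective (trans (sym eq) eq′)) }))
    where
    #r : Rext u w HasCard 1
    #r = subst (Rext u w HasCard_) r≡1 (proj₂ (#Rext w))

  -- The left and right letters of a palindrome are the same, so a single left letter makes every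
  -- extension symmetric.
  p≡b : Palindrome w → l w ≡ 1 → p w ≡ b w
  p≡b {w} pal l≡1 = card-unique
    (λ { (Lv , x , eq) → Lv , x , x , eq })
    (λ { (Lv , x , y , refl) → Lv , x ,
      cong (λ y → x ∷ w ∷ʳ y) (card-1 #l (Lext⇔Rext pal .from (ℒ-tail Lv)) (ℒ-init Lv)) })
    (proj₂ (#Pext w)) (proj₂ (#Bext w))
    where
    #l : Lext u w HasCard 1
    #l = subst (Lext u w HasCard_) l≡1 (proj₂ (#Lext w))

  -- The balance holds automatically here, which extends a condition on bispecial factors to all
  -- factors.
  one-sided : l w ≡ 1 ⊎ r w ≡ 1 → left w ≡ right w
  one-sided {w} one = left≡right⇔ w .from (nonpalindrome one , palindrome)
    where
    nonpalindrome : l w ≡ 1 ⊎ r w ≡ 1 → ¬ Palindrome w → b w + 1 ≡ r w + l w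
    nonpalindrome (inj₁ l≡1) _ = cong₂ _+_ (b≡r l≡1) (sym l≡1)
    nonpalindrome (inj₂ r≡1) _ = trans (+-comm (b w) 1) (cong₂ _+_ (sym r≡1) (b≡l r≡1))
    palindrome : Palindrome w → b w + 1 + 1 ≡ r w + l w + p w
    -- All of `b w`, `r w`, `l w` and `p w` equal 1.
    palindrome pal = trans (cong₂ (λ b l → b + l + 1) (b≡r l≡1) (sym l≡1))
      (cong (λ n → r w + l w + n) (sym (trans (p≡b pal l≡1) (trans (b≡r l≡1) (trans (sym (l≡r pal)) l≡1)))))
      where
      l≡1 : l w ≡ 1
      l≡1 = [ id , trans (l≡r pal) ]′ one

  -- Every factor extends on both sides, which excludes the count 0.
  one-sided⊎bispecial : ∀ {m n} → ℒ u w → Lext u w HasCard m → Rext u w HasCard n →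
    (m ≡ 1 ⊎ n ≡ 1) ⊎ BispecialFactor u w
  one-sided⊎bispecial {m = 0} Lw #l _ = contradiction (proj₂ (ℒ-extendˡ closed Lw)) (card-0 #l)
  one-sided⊎bispecial {m = 1} _  _  _ = inj₁ (inj₁ refl)
  one-sided⊎bispecial {m = suc (suc _)} {0} Lw _ #r = contradiction (proj₂ (ℒ-extendʳ Lw)) (card-0 #r)
  one-sided⊎bispecial {m = suc (suc _)} {1} _  _ _  = inj₁ (inj₂ refl)
  one-sided⊎bispecial {m = suc (suc _)} {suc (suc _)} Lw #l #r =
    inj₂ (Lw , (_ , #l , s≤s (s≤s z≤n)) , (_ , #r , s≤s (s≤s z≤n)))

  -- The conditions over the integers.

  b-unique : ∀ {z} → b⟨ u ⟩[ w ]≡ z → z ≡ + b w ℤ.- + r w ℤ.- + l w ℤ.+ 1ℤ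
  b-unique {w} (_ , _ , _ , #e , #r , #l , eq)
    rewrite card-unique id id #e (proj₂ (#Bext w))
          | card-unique id id #r (proj₂ (#Rext w))
          | card-unique id id #l (proj₂ (#Lext w)) = eq

  b-exists : ∀ w → b⟨ u ⟩[ w ]≡ (+ b w ℤ.- + r w ℤ.- + l w ℤ.+ 1ℤ)
  b-exists w = b w , r w , l w , proj₂ (#Bext w) , proj₂ (#Rext w) , proj₂ (#Lext w) , refl

  BilateralOrderCondition : Pred (List 𝒜) a
  BilateralOrderCondition w =
    (¬ Palindrome w → b⟨ u ⟩[ w ]≡ 0ℤ) ×
    (Palindrome w → ∃[ p ] (Pext u w HasCard p) × (b⟨ u ⟩[ w ]≡ + p ℤ.- 1ℤ))

  condition⇔ : ∀ w → BilateralOrderCondition w ⇔ left w ≡ right w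
  condition⇔ w = mk⇔ (left≡right⇔ w .from ∘ balanced) (orders ∘ left≡right⇔ w .to)
    where
    balanced : BilateralOrderCondition w → Balanced w
    balanced (nonpalindrome , palindrome) =
      (λ ¬pal → +-cancelʳ-≡ 1 _ _ (bilateral (b w) (r w) (l w) 1 .from (b-unique (nonpalindrome ¬pal)))) ,
      (λ pal → let q , #q , b≡ = palindrome pal in
        trans (bilateral (b w) (r w) (l w) q .from (b-unique b≡))
          (cong (λ n → r w + l w + n) (card-unique id id #q (proj₂ (#Pext w)))))
    orders : Balanced w → BilateralOrderCondition w
    orders (nonpalindrome , palindrome) =
      (λ ¬pal → subst (b⟨ u ⟩[ w ]≡_)
        (sym (bilateral (b w) (r w) (l w) 1 .to (cong (_+ 1) (nonpalindrome ¬pal)))) (b-exists w)) ,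
      (λ pal → p w , proj₂ (#Pext w) ,
        subst (b⟨ u ⟩[ w ]≡_) (sym (bilateral (b w) (r w) (l w) (p w) .to (palindrome pal))) (b-exists w))

  -- Initial values and periodicity of the palindromic complexity.

  𝒫-0 : 𝒫 0 ≡ 1
  𝒫-0 = card-unique
    (λ { {[]} _ → refl ; {_ ∷ _} ((_ , ()) , _) })
    (λ { refl → ((0 , refl) , refl) , refl })
    (proj₂ (#𝒫 0)) (card-singleton [])

  -- One-letter words are palindromes, and every letter occurs in `u`.
  𝒫-1 : StrictlySurjective _≡_ u → 𝒫 1 ≡ k
  𝒫-1 surjective = card-unique
    (λ { {x ∷ []} _ → x , tt , refl ; {[]} ((_ , ()) , _) ; {_ ∷ _ ∷ _} ((_ , ()) , _) })
    (λ { (x , _ , refl) → let i , uᵢ≡x = surjective x in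
         ((i , cong (_∷ []) (trans (cong u (+-identityʳ i)) uᵢ≡x)) , refl) , refl })
    (proj₂ (#𝒫 1)) (card-map (_∷ []) ∷-injectiveˡ letters)

  -- Termwise equal sums cancel in `sum-difference` and leave the two palindrome counts.
  𝒫-periodic : (∀ {w} → ℒ u w → left w ≡ right w) → ∀ n → 𝒫 (2 + n) ≡ 𝒫 n
  𝒫-periodic eq n = +-cancelˡ-≡ (sum (map left (factors n))) _ _
    (trans (sum-difference n) (cong (_+ 𝒫 n) (≤-antisym
      (sum-≤ (factors n) (≤-reflexive ∘ sym ∘ eq ∘ proj₁ ∘ ∈-factors .to))
      (sum-≤ (factors n) (≤-reflexive ∘ eq ∘ proj₁ ∘ ∈-factors .to)))))

theorem26 : ∀ {a} {𝒜 : Set a} (k : ℕ) → 𝒜 ↔ Fin k →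
    (u : ℕ → 𝒜) → StrictlySurjective _≡_ u →
    ClosedUnderReversal u →
    (∀ n → 𝒞⟨ u ⟩[ n ]≡ (k ∸ 1) * n + 1) →
    (∀ n → ∃[ p ] ∃[ q ] (𝒫⟨ u ⟩[ n ]≡ p) × (𝒫⟨ u ⟩[ suc n ]≡ q) × p + q ≡ k + 1)
    ⇔
    (∀ w → BispecialFactor u w →
    (¬ Palindrome w → b⟨ u ⟩[ w ]≡ 0ℤ) ×
    (Palindrome w → ∃[ p ] (Pext u w HasCard p) × (b⟨ u ⟩[ w ]≡ + p ℤ.- 1ℤ)))
theorem26 k 𝒜↔Fin u surjective closed complexity = mk⇔
  (λ 𝒫-sum w (Lw , _) → condition⇔ w .from (left≡right (𝒫-card-sum 𝒫-sum) (Lw , refl)))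
  (λ condition n → 𝒫 n , 𝒫 (suc n) , proj₂ (#𝒫 n) , proj₂ (#𝒫 (suc n)) , constant (balanced condition) n)
  where
  open Languages k 𝒜↔Fin u closed complexity

  𝒫-card-sum : (∀ n → ∃[ p ] ∃[ q ] (𝒫⟨ u ⟩[ n ]≡ p) × (𝒫⟨ u ⟩[ suc n ]≡ q) × p + q ≡ k + 1) →
    ∀ n → 𝒫 n + 𝒫 (suc n) ≡ k + 1
  𝒫-card-sum 𝒫-sum n = let _ , _ , #p , #q , eq = 𝒫-sum n in
    trans (cong₂ _+_ (card-unique id id (proj₂ (#𝒫 n)) #p) (card-unique id id (proj₂ (#𝒫 (suc n))) #q)) eq

  balanced : (∀ w → BispecialFactor u w → BilateralOrderCondition w) → ∀ {w} → ℒ u w → left w ≡ right w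
  balanced condition {w} Lw with one-sided⊎bispecial Lw (proj₂ (#Lext w)) (proj₂ (#Rext w))
  ... | inj₁ one       = one-sided one
  ... | inj₂ bispecial = condition⇔ w .to (condition w bispecial)

  constant : (∀ {w} → ℒ u w → left w ≡ right w) → ∀ n → 𝒫 n + 𝒫 (suc n) ≡ k + 1
  constant eq zero    = trans (cong₂ _+_ 𝒫-0 (𝒫-1 surjective)) (+-comm 1 k)
  -- By periodicity the new sum has the same two summands as the previous one, in the other order.
  constant eq (suc n) = trans (cong (λ m → 𝒫 (suc n) + m) (𝒫-periodic eq n))
    (trans (+-comm (𝒫 (suc n)) (𝒫 n)) (constant eq n))
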